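{- Let $N=p_{1}^{\alpha_{1}}\cdots p_{r}^{\alpha_{r}}$ with $r\geq 1$, $p_1,\ldots,p_r$ pairwise distinct prime numbers and $\alpha_1,\ldots,\alpha_r$ positive integers. Let $k=a\,p_{1}^{\beta_{1}}\cdots p_{r}^{\beta_{r}}$ where $1\leq\beta_i\leq\alpha_i$ for all $i$ and $a$ is an integer not divisible by any of the $p_i$. Then the $\overline{k}$-monomial minimal solution of $(E_{N})$ has size $2p_{1}^{\alpha_{1}-\beta_{1}}\cdots p_{r}^{\alpha_{r}-\beta_{r}}$.
   Context: Let $N\geq 2$ be an integer and write $\overline{a}=a+N\mathbb{Z}$ for $a\in\mathbb{Z}$. For $\overline{a_1},\ldots,\overline{a_s}\in\mathbb{Z}/N\mathbb{Z}$ put $$M_s(\overline{a_1},\ldots,\overline{a_s})=\begin{pmatrix}\overline{a_s}&-\overline{1}\\ \overline{1}&\overline{0}\end{pmatrix}\begin{pmatrix}\overline{a_{s-1}}&-\overline{1}\\ \overline{1}&\overline{0}\end{pmatrix}\cdots\begin{pmatrix}\overline{a_1}&-\overline{1}\\ \overline{1}&\overline{0}\end{pmatrix}.$$ A solution of $(E_N)$ of size $s$ ($s\geq 1$) is an $s$-tuple $(\overline{a_1},\ldots,\overline{a_s})\in(\mathbb{Z}/N\mathbb{Z})^s$ with $M_s(\overline{a_1},\ldots,\overline{a_s})=\pm \mathrm{Id}$ over $\mathbb{Z}/N\mathbb{Z}$. For $\overline{k}\in\mathbb{Z}/N\mathbb{Z}$, the $\overline{k}$-monomial minimal solution of $(E_N)$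 is the tuple $(\overline{k},\ldots,\overline{k})$ of size $s$, where $s\geq 1$ is the smallest integer such that the $s$-tuple with all entries equal to $\overline{k}$ is a solution of $(E_N)$ (it exists and is unique). -}

module Defs where

open import Algebra.Bundles using (CommutativeRing)
open import Data.Integer.Base as ℤ using (ℤ; +_; _+_; _*_; -_; _-_; 0ℤ; 1ℤ)
open import Data.Integer.Divisibility.Signed
  using (_∣_; divides; ∣m∣n⇒∣m+n; ∣m⇒∣-m; ∣n⇒∣m*n)
open import Data.Integer.Properties as ℤ using (+-*-commutativeRing)
open import Data.Integer.Tactic.RingSolver using (solve-∀)
open import Data.Nat.Base using (ℕ; _≤_)
open import Data.Nat.Properties using (*-1-commutativeMonoid)
open import Data.Product.Base using (_×_; _,_)
open import Data.Sum.Base using (_⊎_)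
open import Data.Vec.Base using (Vec; []; _∷_; replicate)
open import Data.Vec.Relation.Binary.Pointwise.Inductive using (Pointwise)
open import Level using (Level; 0ℓ; _⊔_)
open import Relation.Binary.PropositionalEquality.Core using (_≡_; refl; sym; subst)

-- Algebraic "sum" in the commutative monoid (ℕ, *, 1), i.e. the product p₁ ⋯ pᵣ.
open import Algebra.Properties.CommutativeMonoid.Sum *-1-commutativeMonoid public
  using () renaming (sum to ∏)

-- ℤ/Nℤ is the setoid of integers under congruence: an integer a stands for
-- its own class a + Nℤ.

infix 4 _≡_[mod_]

record _≡_[mod_] (i j : ℤ) (N : ℕ) : Set where
  constructor congruent
  field
    N∣i-j : + N ∣ i - j

open _≡_[mod_] public

module _ (N : ℕ) where

  private
    _≈_ : ℤ → ℤ → Set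
    i ≈ j = i ≡ j [mod N ]

    via : ∀ {i j m} → m ≡ i - j → + N ∣ m → i ≈ j
    via eq d = congruent (subst (+ N ∣_) eq d)

    reflexive : ∀ {i j} → i ≡ j → i ≈ j
    reflexive {i} refl = via (sym (ℤ.+-inverseʳ i)) (divides 0ℤ refl)

    neg-diff : ∀ i j → - (i - j) ≡ j - i
    neg-diff = solve-∀

    neg-cong : ∀ i j → - (i - j) ≡ - i - - j
    neg-cong = solve-∀

    diff-trans : ∀ i j k → (i - j) + (j - k) ≡ i - k
    diff-trans = solve-∀

    add-cong : ∀ i j k l → (i - j) + (k - l) ≡ (i + k) - (j + l)
    add-cong = solve-∀

    mul-cong : ∀ i j k l → k * (i - j) + j * (k - l) ≡ i * k - j * l
    mul-cong = solve-∀

  ℤ/ : CommutativeRing 0ℓ 0ℓ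
  ℤ/ = record
    { Carrier = ℤ
    ; _≈_ = _≈_
    ; _+_ = _+_
    ; _*_ = _*_
    ; -_  = -_
    ; 0#  = 0ℤ
    ; 1#  = 1ℤ
    ; isCommutativeRing = record
      { isRing = record
        { +-isAbelianGroup = record
          { isGroup = record
            { isMonoid = record
              { isSemigroup = record
                { isMagma = record
                  { isEquivalence = record
                    { refl  = reflexive refl
                    ; sym   = λ {i} {j} p → via (neg-diff i j) (∣m⇒∣-m (N∣i-j p))
                    ; trans = λ {i} {j} {k} p q →
                        via (diff-trans i j k) (∣m∣n⇒∣m+n (N∣i-j p) (N∣i-j q))
                    }
                  ; ∙-cong = λ {i} {j} {k} {l} p q →
                      via (add-cong i j k l) (∣m∣n⇒∣m+n (N∣i-j p) (N∣i-j q))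
                  }
                ; assoc = λ i j k → reflexive (ℤ.+-assoc i j k)
                }
              ; identity = (λ i → reflexive (ℤ.+-identityˡ i))
                         , (λ i → reflexive (ℤ.+-identityʳ i))
              }
            ; inverse = (λ i → reflexive (ℤ.+-inverseˡ i))
                      , (λ i → reflexive (ℤ.+-inverseʳ i))
            ; ⁻¹-cong = λ {i} {j} p → via (neg-cong i j) (∣m⇒∣-m (N∣i-j p))
            }
          ; comm = λ i j → reflexive (ℤ.+-comm i j)
          }
        ; *-cong = λ {i} {j} {k} {l} p q →
            via (mul-cong i j k l)
                (∣m∣n⇒∣m+n (∣n⇒∣m*n k (N∣i-j p)) (∣n⇒∣m*n j (N∣i-j q)))
        ; *-assoc = λ i j k → reflexive (ℤ.*-assoc i j k)
        ; *-identity = (λ i → reflexive (ℤ.*-identityˡ i))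
                     , (λ i → reflexive (ℤ.*-identityʳ i))
        ; distrib = (λ i j k → reflexive (ℤ.*-distribˡ-+ i j k))
                  , (λ i j k → reflexive (ℤ.*-distribʳ-+ i j k))
        }
      ; *-comm = λ i j → reflexive (ℤ.*-comm i j)
      }
    }

module Matrices {c ℓ : Level} (R : CommutativeRing c ℓ) where

  private module R = CommutativeRing R

  -- mat a b c d has first row (a b) and second row (c d).
  record Mat₂ : Set c where
    constructor mat
    field
      e₁₁ e₁₂ e₂₁ e₂₂ : R.Carrier

  open Mat₂ public

  infix 4 _≋_
  record _≋_ (A B : Mat₂) : Set ℓ where
    constructor mat-≈
    field
      ≈₁₁ : e₁₁ A R.≈ e₁₁ B
      ≈₁₂ : e₁₂ A R.≈ e₁₂ B
      ≈₂₁ : e₂₁ A R.≈ e₂₁ B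
      ≈₂₂ : e₂₂ A R.≈ e₂₂ B

  infixl 7 _·_
  _·_ : Mat₂ → Mat₂ → Mat₂
  mat a b c d · mat a′ b′ c′ d′ =
    mat (a R.* a′ R.+ b R.* c′) (a R.* b′ R.+ b R.* d′)
        (c R.* a′ R.+ d R.* c′) (c R.* b′ R.+ d R.* d′)

  -Mat_ : Mat₂ → Mat₂
  -Mat mat a b c d = mat (R.- a) (R.- b) (R.- c) (R.- d)

  Id : Mat₂
  Id = mat R.1# R.0# R.0# R.1#

  -- The first entry of the tuple gives the rightmost factor.
  M : ∀ {s} → Vec R.Carrier s → Mat₂
  M []       = Id
  M (a ∷ as) = M as · mat a (R.- R.1#) R.1# R.0#

module Equation (N : ℕ) where

  open CommutativeRing (ℤ/ N) using (Carrier; _≈_)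
  open Matrices (ℤ/ N)

  IsSolution : ∀ {s} → Vec Carrier s → Set
  IsSolution {s} as = 1 ≤ s × (M as ≋ Id ⊎ M as ≋ -Mat Id)

  record IsMonomialMinimalSolution (k : Carrier) {s : ℕ} (as : Vec Carrier s) : Set where
    field
      monomial   : Pointwise _≈_ as (replicate s k)
      isSolution : IsSolution as
      minimal    : ∀ t → IsSolution (replicate t k) → s ≤ t

{-# OPTIONS --safe #-}
module Submission where

-- Powers of M₁(k) = (k -1; 1 0) have entries ±U k n, where U k is the Lucas sequence
-- with parameters (k, 1).  A prime dividing k divides no U k n with n odd, so solutions
-- have even size 2m, and up to sign U k (2m) = k U σ m for σ = 2 - k².  Let V m be the
-- trace of (-M₁(k)²)ᵐ.  Since σ ≡ 2 modulo k², also V m ≡ 2, and the composition law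
-- U σ (q m) = U (V m) q · U σ m gives U σ (q m) = q · (1 + z k) · U σ m whenever q ∣ k.
-- Stripping off one prime factor at a time, Q ∣ U σ m forces Q ∣ m for every product Q of
-- primes dividing k, hence minimality.  Conversely, if (-M₁(k)²)ᵐ ≡ Id modulo c with
-- k ∣ c, then its q-th power is ≡ Id modulo q c, for every q ∣ k.

open import Defs
import Data.Nat.Properties as ℕ
open import Algebra.Bundles using (CommutativeRing)
open import Algebra.Properties.CommutativeMonoid.Sum ℕ.*-1-commutativeMonoid
  using (sum-cong-≋; ∑-distrib-+)
open import Data.Fin.Base using (Fin; zero; suc)
open import Data.Integer.Base as ℤ using (ℤ; +_; -_; _-_; 0ℤ; 1ℤ)
open import Data.Integer.Divisibility as ℤ using ()
open import Data.Integer.Divisibility.Signed as Signed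
  using (divides; ∣ᵤ⇒∣; ∣⇒∣ᵤ; ∣-refl; ∣-trans; ∣m∣n⇒∣m+n; ∣m⇒∣-m; ∣m∣n⇒∣m-n;
         ∣n⇒∣m*n; ∣m⇒∣m*n; *-monoʳ-∣; *-monoˡ-∣; *-cancelˡ-∣; *-cancelʳ-∣)
open import Data.Integer.Properties as ℤ using ()
open import Data.Integer.Tactic.RingSolver using (solve-∀)
import Data.Nat.Divisibility as ℕ
open import Data.Nat.Base using (ℕ; zero; suc; _≤_; _+_; _*_; _^_; _∸_; NonZero; z≤n; s≤s; >-nonZero⁻¹)
import Data.Nat.DivMod as ℕ
open import Data.Nat.Primality using (Prime; prime⇒nonZero; euclidsLemma; ¬prime[1])
open import Data.Product.Base using (Σ-syntax; ∃-syntax; _×_; _,_; proj₁; proj₂)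
open import Data.Sum.Base using (_⊎_; inj₁; inj₂; [_,_]′)
open import Data.Vec.Base using (Vec; replicate)
import Data.Vec.Relation.Binary.Pointwise.Inductive as Pointwise
open import Function.Base using (_∘_)
open import Function.Definitions using (Injective)
open import Relation.Binary.PropositionalEquality
  using (_≡_; refl; sym; trans; cong; cong₂; subst; subst₂; module ≡-Reasoning)
open import Relation.Nullary.Negation.Core using (¬_; contradiction)

open Signed using (_∣_)

-- Lucas sequences with parameters (t, 1).

IsLucas : ℤ → (ℕ → ℤ) → Set
IsLucas t w = ∀ n → w (2 + n) ≡ t ℤ.* w (1 + n) - w n

U : ℤ → ℕ → ℤ
U t 0             = 0ℤ
U t 1             = 1ℤ
U t (suc (suc n)) = t ℤ.* U t (suc n) - U t n

U-isLucas : ∀ t → IsLucas t (U t)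
U-isLucas t n = refl

-- The recurrence fixes `w` by its first two values. The coefficient of `w 0` is -U (n - 1), written
-- so that no index is negative.
U-basis : ∀ {t w} → IsLucas t w → ∀ n →
          w n ≡ U t n ℤ.* w 1 ℤ.+ (U t (suc n) - t ℤ.* U t n) ℤ.* w 0
U-basis {t} {w} rec zero = base t (w 1) (w 0)
  where
  base : ∀ t y x → x ≡ 0ℤ ℤ.* y ℤ.+ (1ℤ - t ℤ.* 0ℤ) ℤ.* x
  base = solve-∀
U-basis {t} {w} rec (suc n) = begin
  w (suc n)
    ≡⟨ U-basis (rec ∘ suc) n ⟩
  U t n ℤ.* w 2 ℤ.+ (U t (suc n) - t ℤ.* U t n) ℤ.* w 1
    ≡⟨ cong (λ z → U t n ℤ.* z ℤ.+ (U t (suc n) - t ℤ.* U t n) ℤ.* w 1) (rec 0) ⟩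
  U t n ℤ.* (t ℤ.* w 1 - w 0) ℤ.+ (U t (suc n) - t ℤ.* U t n) ℤ.* w 1
    ≡⟨ step t (U t n) (U t (suc n)) (w 0) (w 1) ⟩
  U t (suc n) ℤ.* w 1 ℤ.+ (U t (2 + n) - t ℤ.* U t (suc n)) ℤ.* w 0 ∎
  where
  open ≡-Reasoning
  step : ∀ t u u′ x y →
    u ℤ.* (t ℤ.* y - x) ℤ.+ (u′ - t ℤ.* u) ℤ.* y ≡
    u′ ℤ.* y ℤ.+ (t ℤ.* u′ - u - t ℤ.* u′) ℤ.* x
  step = solve-∀

-- One step of the recurrence preserves the form x² - t x y + y², because the companion matrix has
-- determinant 1.
U-norm : ∀ t n →
  U t (suc n) ℤ.* U t (suc n) - t ℤ.* U t (suc n) ℤ.* U t n ℤ.+ U t n ℤ.* U t n ≡ 1ℤ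
U-norm t zero = base t
  where
  base : ∀ t → 1ℤ ℤ.* 1ℤ - t ℤ.* 1ℤ ℤ.* 0ℤ ℤ.+ 0ℤ ℤ.* 0ℤ ≡ 1ℤ
  base = solve-∀
U-norm t (suc n) = trans (step t (U t n) (U t (suc n))) (U-norm t n)
  where
  step : ∀ t u u′ →
    (t ℤ.* u′ - u) ℤ.* (t ℤ.* u′ - u) - t ℤ.* (t ℤ.* u′ - u) ℤ.* u′ ℤ.+ u′ ℤ.* u′ ≡
    u′ ℤ.* u′ - t ℤ.* u′ ℤ.* u ℤ.+ u ℤ.* u
  step = solve-∀

-- The companion sequence V m = U (m + 1) - U (m - 1), avoiding the index -1.
V : ℤ → ℕ → ℤ
V t m = + 2 ℤ.* U t (suc m) - t ℤ.* U t m

module _ {t : ℤ} {w : ℕ → ℤ} (rec : IsLucas t w) (m : ℕ) where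

  -- Cayley-Hamilton for the m-th power of the companion matrix, whose trace is `V t m` and whose
  -- determinant is 1 by `U-norm`. Hence every m-th term of `w` forms a Lucas sequence with
  -- parameter `V t m`.
  stride : ∀ a → w (m + (m + a)) ≡ V t m ℤ.* w (m + a) - w a
  stride a = begin
    w (m + (m + a))
      ≡⟨ U-basis {w = λ n → w (n + (m + a))} (λ n → rec (n + (m + a))) m ⟩
    U t m ℤ.* w (suc (m + a)) ℤ.+ (U t (suc m) - t ℤ.* U t m) ℤ.* w (m + a)
      ≡⟨ cong₂ (λ y z → U t m ℤ.* y ℤ.+ (U t (suc m) - t ℤ.* U t m) ℤ.* z) next here ⟩
    U t m ℤ.* (U t m ℤ.* (t ℤ.* w (suc a) - w a) ℤ.+ (U t (suc m) - t ℤ.* U t m) ℤ.* w (suc a))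
      ℤ.+ (U t (suc m) - t ℤ.* U t m) ℤ.* wₘ
      ≡⟨ ring t (U t m) (U t (suc m)) (w a) (w (suc a)) ⟩
    V t m ℤ.* wₘ -
      (U t (suc m) ℤ.* U t (suc m) - t ℤ.* U t (suc m) ℤ.* U t m ℤ.+ U t m ℤ.* U t m) ℤ.* w a
      ≡⟨ cong₂ (λ x y → V t m ℤ.* x - y) (sym here) (trans (cong (ℤ._* w a) (U-norm t m)) (ℤ.*-identityˡ (w a))) ⟩
    V t m ℤ.* w (m + a) - w a ∎
    where
    open ≡-Reasoning
    wₘ = U t m ℤ.* w (suc a) ℤ.+ (U t (suc m) - t ℤ.* U t m) ℤ.* w a
    here : w (m + a) ≡ wₘ
    here = U-basis {w = λ n → w (n + a)} (λ n → rec (n + a)) m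
    next : w (suc (m + a)) ≡
      U t m ℤ.* (t ℤ.* w (suc a) - w a) ℤ.+ (U t (suc m) - t ℤ.* U t m) ℤ.* w (suc a)
    next = trans (U-basis {w = λ n → w (suc (n + a))} (λ n → rec (suc (n + a))) m)
                 (cong (λ z → U t m ℤ.* z ℤ.+ (U t (suc m) - t ℤ.* U t m) ℤ.* w (suc a)) (rec a))
    ring : ∀ t u u′ x y →
      u ℤ.* (u ℤ.* (t ℤ.* y - x) ℤ.+ (u′ - t ℤ.* u) ℤ.* y)
        ℤ.+ (u′ - t ℤ.* u) ℤ.* (u ℤ.* y ℤ.+ (u′ - t ℤ.* u) ℤ.* x) ≡
      (+ 2 ℤ.* u′ - t ℤ.* u) ℤ.* (u ℤ.* y ℤ.+ (u′ - t ℤ.* u) ℤ.* x) -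
        (u′ ℤ.* u′ - t ℤ.* u′ ℤ.* u ℤ.+ u ℤ.* u) ℤ.* x
    ring = solve-∀

  multiples : ∀ n → w (n * m) ≡
    U (V t m) n ℤ.* w m ℤ.+ (U (V t m) (suc n) - V t m ℤ.* U (V t m) n) ℤ.* w 0
  multiples n = trans
    (U-basis {w = λ n → w (n * m)} (λ n → stride (n * m)) n)
    (cong (λ i → U (V t m) n ℤ.* w i ℤ.+ (U (V t m) (suc n) - V t m ℤ.* U (V t m) n) ℤ.* w 0)
          (ℕ.*-identityˡ m))

U-* : ∀ t n m → U t (n * m) ≡ U (V t m) n ℤ.* U t m
U-* t n m = trans (multiples (U-isLucas t) m n)
  (ring (U (V t m) n ℤ.* U t m) (U (V t m) (suc n) - V t m ℤ.* U (V t m) n))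
  where
  ring : ∀ x y → x ℤ.+ y ℤ.* 0ℤ ≡ x
  ring = solve-∀

-- The Lucas sequence starting 1, t - 1; at `σ k` it gives, up to sign, the odd-indexed terms of
-- `U k`.
D : ℤ → ℕ → ℤ
D t n = U t (suc n) - U t n

D-isLucas : ∀ t → IsLucas t (D t)
D-isLucas t n = ring t (U t n) (U t (suc n))
  where
  ring : ∀ t u u′ → t ℤ.* (t ℤ.* u′ - u) - u′ - (t ℤ.* u′ - u) ≡ t ℤ.* (t ℤ.* u′ - u - u′) - (u′ - u)
  ring = solve-∀

-- Arranged so that every term is small once `V t m` is close to 2 and `D t m` to 1.
D-* : ∀ t n m → D t (n * m) - 1ℤ ≡
  U (V t m) n ℤ.* (D t m - 1ℤ) ℤ.+ (D (V t m) n - 1ℤ) - (V t m - + 2) ℤ.* U (V t m) n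
D-* t n m = trans (cong (_- 1ℤ) (multiples (D-isLucas t) m n))
  (ring (V t m) (U (V t m) n) (U (V t m) (suc n)) (D t m))
  where
  ring : ∀ v u u′ x → u ℤ.* x ℤ.+ (u′ - v ℤ.* u) ℤ.* 1ℤ - 1ℤ ≡
    u ℤ.* (x - 1ℤ) ℤ.+ (u′ - u - 1ℤ) - (v - + 2) ℤ.* u
  ring = solve-∀

-- Adding a multiple of `U-norm` exposes a square of `D t m - 1`, the source of the extra factor q
-- in `trivial-*`.
V-2≡ : ∀ t m → V t m - + 2 ≡
  (t - + 2) ℤ.* U t m ℤ.* (U t (suc m) - 1ℤ) - (D t m - 1ℤ) ℤ.* (D t m - 1ℤ)
V-2≡ t m = begin
  V t m - + 2                           ≡⟨ ring t (U t m) (U t (suc m)) ⟩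
  rhs ℤ.+ (norm - 1ℤ)                   ≡⟨ cong (λ x → rhs ℤ.+ (x - 1ℤ)) (U-norm t m) ⟩
  rhs ℤ.+ 0ℤ                            ≡⟨ ℤ.+-identityʳ rhs ⟩
  rhs                                   ∎
  where
  open ≡-Reasoning
  rhs = (t - + 2) ℤ.* U t m ℤ.* (U t (suc m) - 1ℤ) - (D t m - 1ℤ) ℤ.* (D t m - 1ℤ)
  norm = U t (suc m) ℤ.* U t (suc m) - t ℤ.* U t (suc m) ℤ.* U t m ℤ.+ U t m ℤ.* U t m
  ring : ∀ t u u′ → + 2 ℤ.* u′ - t ℤ.* u - + 2 ≡
    (t - + 2) ℤ.* u ℤ.* (u′ - 1ℤ) - (u′ - u - 1ℤ) ℤ.* (u′ - u - 1ℤ)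
      ℤ.+ (u′ ℤ.* u′ - t ℤ.* u′ ℤ.* u ℤ.+ u ℤ.* u - 1ℤ)
  ring = solve-∀

-- Congruences when t ≡ 2 modulo e.

module _ {e t : ℤ} (e∣t-2 : e ∣ t - + 2) where

  -- For parameter 2 the recurrence produces arithmetic progressions.
  U≡n : ∀ n → e ∣ U t n - + n
  U≡n 0             = divides 0ℤ refl
  U≡n 1             = divides 0ℤ refl
  U≡n (suc (suc n)) = subst (e ∣_) (ring t (U t n) (U t (suc n)) (+ n))
    (∣m∣n⇒∣m-n (∣m∣n⇒∣m+n (∣m⇒∣m*n (U t (suc n)) e∣t-2) (∣n⇒∣m*n (+ 2) (U≡n (suc n)))) (U≡n n))
    where
    ring : ∀ t u u′ x →
      (t - + 2) ℤ.* u′ ℤ.+ + 2 ℤ.* (u′ - (1ℤ ℤ.+ x)) - (u - x) ≡ t ℤ.* u′ - u - (+ 2 ℤ.+ x)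
    ring = solve-∀

  D≡1 : ∀ n → e ∣ D t n - 1ℤ
  D≡1 n = subst (e ∣_) (ring (U t n) (U t (suc n)) (+ n)) (∣m∣n⇒∣m-n (U≡n (suc n)) (U≡n n))
    where
    ring : ∀ u u′ x → u′ - (1ℤ ℤ.+ x) - (u - x) ≡ u′ - u - 1ℤ
    ring = solve-∀

  V≡2 : ∀ m → e ∣ V t m - + 2
  V≡2 m = subst (e ∣_) (sym (V-2≡ t m))
    (∣m∣n⇒∣m-n (∣m⇒∣m*n (U t (suc m) - 1ℤ) (∣m⇒∣m*n (U t m) e∣t-2)) (∣m⇒∣m*n (D t m - 1ℤ) (D≡1 m)))

-- Divisibility in ℤ, and the sequences at parameter `σ k`.

∣x-y⇒∣y⇒∣x : ∀ {e x y} → e ∣ x - y → e ∣ y → e ∣ x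
∣x-y⇒∣y⇒∣x {e} {x} {y} e∣x-y e∣y = subst (e ∣_) (ring x y) (∣m∣n⇒∣m+n e∣x-y e∣y)
  where
  ring : ∀ x y → x - y ℤ.+ y ≡ x
  ring = solve-∀

∣x-y⇒∣x⇒∣y : ∀ {e x y} → e ∣ x - y → e ∣ x → e ∣ y
∣x-y⇒∣x⇒∣y {e} {x} {y} e∣x-y e∣x = subst (e ∣_) (ring x y) (∣m∣n⇒∣m-n e∣x e∣x-y)
  where
  ring : ∀ x y → x - (x - y) ≡ y
  ring = solve-∀

*-mono-∣ : ∀ {a b c d} → a ∣ b → c ∣ d → a ℤ.* c ∣ b ℤ.* d
*-mono-∣ {a} {b} {c} {d} a∣b c∣d = ∣-trans (*-monoˡ-∣ c a∣b) (*-monoʳ-∣ b c∣d)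

-- The trace of -M₁(k)², which is chosen over M₁(k)² because it is ≡ 2 modulo k².
σ : ℤ → ℤ
σ k = + 2 - k ℤ.* k

σ-2 : ∀ k → σ k - + 2 ≡ - (k ℤ.* k)
σ-2 = ring
  where
  ring : ∀ k → + 2 - k ℤ.* k - + 2 ≡ - (k ℤ.* k)
  ring = solve-∀

k²∣σ-2 : ∀ k → k ℤ.* k ∣ σ k - + 2
k²∣σ-2 k = subst (k ℤ.* k ∣_) (sym (σ-2 k)) (∣m⇒∣-m ∣-refl)

k∣σ-2 : ∀ k → k ∣ σ k - + 2
k∣σ-2 k = ∣-trans (∣m⇒∣m*n k ∣-refl) (k²∣σ-2 k)

-- `U (V m) q` differs from q by a multiple of k². One factor k pays for q; the other keeps the
-- cofactor ≡ 1 modulo k, so prime to every prime dividing k.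
U-dilate : ∀ {k q} m → + q ∣ k →
  ∃[ z ] U (σ k) (q * m) ≡ + q ℤ.* (1ℤ ℤ.+ z ℤ.* k) ℤ.* U (σ k) m
U-dilate {k} {q} m (divides k′ k≡k′q)
  with divides z eq ← U≡n (V≡2 (k²∣σ-2 k) m) q
  = z ℤ.* k′ , trans (U-* (σ k) q m) (cong (ℤ._* U (σ k) m) (begin
      u                                    ≡⟨ ring₁ u (+ q) ⟩
      u - + q ℤ.+ + q                      ≡⟨ cong (ℤ._+ + q) eq ⟩
      z ℤ.* (k ℤ.* k) ℤ.+ + q              ≡⟨ cong (λ x → z ℤ.* (x ℤ.* k) ℤ.+ + q) k≡k′q ⟩
      z ℤ.* (k′ ℤ.* + q ℤ.* k) ℤ.+ + q     ≡⟨ ring₂ z k′ k (+ q) ⟩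
      + q ℤ.* (1ℤ ℤ.+ z ℤ.* k′ ℤ.* k)      ∎))
  where
  open ≡-Reasoning
  u = U (V (σ k) m) q
  ring₁ : ∀ x y → x ≡ x - y ℤ.+ y
  ring₁ = solve-∀
  ring₂ : ∀ z k′ k q → z ℤ.* (k′ ℤ.* q ℤ.* k) ℤ.+ q ≡ q ℤ.* (1ℤ ℤ.+ z ℤ.* k′ ℤ.* k)
  ring₂ = solve-∀

-- By Cayley–Hamilton, (-M₁(k)²)ᵐ = (D + k² U) Id - k U M₁(k), with D and U taken
-- at σ k and m: both divisibilities together make this ≡ Id modulo c.
record Trivial (k c : ℤ) (m : ℕ) : Set where
  field
    c∣kU  : c ∣ k ℤ.* U (σ k) m
    c∣D-1 : c ∣ D (σ k) m - 1ℤ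

-- Modulo k the square of M₁(k) is -Id.
trivial-1 : ∀ k → Trivial k k 1
trivial-1 k = record
  { c∣kU  = ∣m⇒∣m*n 1ℤ ∣-refl
  ; c∣D-1 = D≡1 {t = σ k} (k∣σ-2 k) 1
  }

-- `U` gains the factor q by `U-dilate`; `D` gains it by `D-*`, all of whose terms are divisible by
-- q c once v ≡ 2 modulo q c.
trivial-* : ∀ {k c m q} → + q ∣ k → k ∣ c → Trivial k c m → Trivial k (+ q ℤ.* c) (q * m)
trivial-* {k} {c} {m} {q} q∣k k∣c tr = record
  { c∣kU  = let z , eq = U-dilate m q∣k in
      subst (+ q ℤ.* c ∣_)
        (trans (ring₁ k (+ q) z (U (σ k) m)) (cong (k ℤ.*_) (sym eq)))
        (*-monoʳ-∣ (+ q) (∣n⇒∣m*n (1ℤ ℤ.+ z ℤ.* k) c∣kU))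
  ; c∣D-1 = subst (+ q ℤ.* c ∣_) (sym (D-* (σ k) q m))
      (∣m∣n⇒∣m-n
        (∣m∣n⇒∣m+n (*-mono-∣ q∣U c∣D-1) (D≡1 qc∣v-2 q))
        (∣m⇒∣m*n (U v q) qc∣v-2))
  }
  where
  open Trivial tr
  v = V (σ k) m
  ring₁ : ∀ k q z u → q ℤ.* ((1ℤ ℤ.+ z ℤ.* k) ℤ.* (k ℤ.* u)) ≡ k ℤ.* (q ℤ.* (1ℤ ℤ.+ z ℤ.* k) ℤ.* u)
  ring₁ = solve-∀
  ring₂ : ∀ k u → - (k ℤ.* (k ℤ.* u)) ≡ - (k ℤ.* k) ℤ.* u
  ring₂ = solve-∀
  -- In `V-2≡` the first term contains k · (k U), where q divides k and c divides k U; in the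
  -- square, q ∣ k ∣ c divides one factor and c the other.
  qc∣v-2 : + q ℤ.* c ∣ v - + 2
  qc∣v-2 = subst (+ q ℤ.* c ∣_) (sym (V-2≡ (σ k) m))
    (∣m∣n⇒∣m-n
      (∣m⇒∣m*n (U (σ k) (suc m) - 1ℤ)
        (subst (+ q ℤ.* c ∣_)
          (trans (ring₂ k (U (σ k) m)) (cong (ℤ._* U (σ k) m) (sym (σ-2 k))))
          (∣m⇒∣-m (*-mono-∣ q∣k c∣kU))))
      (*-mono-∣ (∣-trans q∣k (∣-trans k∣c c∣D-1)) c∣D-1))
  q∣U : + q ∣ U v q
  q∣U = ∣x-y⇒∣y⇒∣x (U≡n (∣-trans (∣m⇒∣m*n c ∣-refl) qc∣v-2) q) ∣-refl

-- Signs, and the passage from `U k` to the sequences at `σ k`.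

ε : ℕ → ℤ
ε zero    = 1ℤ
ε (suc n) = - ε n

ε≡±1 : ∀ n → ε n ≡ 1ℤ ⊎ ε n ≡ - 1ℤ
ε≡±1 zero    = inj₁ refl
ε≡±1 (suc n) = [ inj₂ ∘ cong (-_) , inj₁ ∘ cong (-_) ]′ (ε≡±1 n)

-- As a polynomial in t, `U t n` has the parity of n - 1; the sign (-1)ⁿ⁻¹ is written `- ε n` to
-- allow n = 0.
U-neg : ∀ {t t′} → t′ ≡ - t → ∀ n → U t′ n ≡ - (ε n ℤ.* U t n)
U-neg {t} refl 0             = refl
U-neg {t} refl 1             = refl
U-neg {t} refl (suc (suc n)) = trans
  (cong₂ (λ x y → - t ℤ.* x - y) (U-neg {t} refl (suc n)) (U-neg {t} refl n))
  (ring t (ε n) (U t n) (U t (suc n)))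
  where
  ring : ∀ t e u u′ →
    - t ℤ.* - (- e ℤ.* u′) - - (e ℤ.* u) ≡ - (- - e ℤ.* (t ℤ.* u′ - u))
  ring = solve-∀

V₂≡-σ : ∀ k → V k 2 ≡ - σ k
V₂≡-σ = ring
  where
  ring : ∀ k → + 2 ℤ.* (k ℤ.* (k ℤ.* 1ℤ - 0ℤ) - 1ℤ) - k ℤ.* (k ℤ.* 1ℤ - 0ℤ) ≡ - (+ 2 - k ℤ.* k)
  ring = solve-∀

U-even : ∀ k m → U k (m * 2) ≡ - ε m ℤ.* (k ℤ.* U (σ k) m)
U-even k m = trans (U-* k m 2)
  (trans (cong (ℤ._* U k 2) (U-neg (V₂≡-σ k) m)) (ring k (ε m) (U (σ k) m)))
  where
  ring : ∀ k e u → - (e ℤ.* u) ℤ.* (k ℤ.* 1ℤ - 0ℤ) ≡ - e ℤ.* (k ℤ.* u)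
  ring = solve-∀

-- The terms of odd index again follow a Lucas recurrence with parameter `V k 2`, starting from
-- `U k 1` and `U k 3`.
U-odd : ∀ k m → U k (suc (m * 2)) ≡ ε m ℤ.* D (σ k) m
U-odd k m = begin
  U k (suc (m * 2))
    ≡⟨ multiples {t = k} {w = U k ∘ suc} (U-isLucas k ∘ suc) 2 m ⟩
  U v m ℤ.* U k 3 ℤ.+ (U v (suc m) - v ℤ.* U v m) ℤ.* 1ℤ
    ≡⟨ ring₁ k (U v m) (U v (suc m)) ⟩
  U v m ℤ.+ U v (suc m)
    ≡⟨ cong₂ ℤ._+_ (U-neg (V₂≡-σ k) m) (U-neg (V₂≡-σ k) (suc m)) ⟩
  - (ε m ℤ.* U (σ k) m) ℤ.+ - (- ε m ℤ.* U (σ k) (suc m))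
    ≡⟨ ring₂ (ε m) (U (σ k) m) (U (σ k) (suc m)) ⟩
  ε m ℤ.* D (σ k) m ∎
  where
  open ≡-Reasoning
  v = V k 2
  ring₁ : ∀ k u u′ →
    u ℤ.* (k ℤ.* (k ℤ.* 1ℤ - 0ℤ) - 1ℤ)
      ℤ.+ (u′ - (+ 2 ℤ.* (k ℤ.* (k ℤ.* 1ℤ - 0ℤ) - 1ℤ) - k ℤ.* (k ℤ.* 1ℤ - 0ℤ)) ℤ.* u) ℤ.* 1ℤ ≡
    u ℤ.+ u′
  ring₁ = solve-∀
  ring₂ : ∀ e u u′ → - (e ℤ.* u) ℤ.+ - (- e ℤ.* u′) ≡ e ℤ.* (u′ - u)
  ring₂ = solve-∀

∣ε*⇒∣ : ∀ {e x} m → e ∣ ε m ℤ.* x → e ∣ x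
∣ε*⇒∣ {e} {x} zero    e∣x = subst (e ∣_) (ℤ.*-identityˡ x) e∣x
∣ε*⇒∣ {e} {x} (suc m) e∣x =
  ∣ε*⇒∣ m (subst (e ∣_) (ring (ε m) x) (∣m⇒∣-m e∣x))
  where
  ring : ∀ y x → - (- y ℤ.* x) ≡ y ℤ.* x
  ring = solve-∀

∣U-even⇒ : ∀ {e k} m → e ∣ U k (m * 2) → e ∣ k ℤ.* U (σ k) m
∣U-even⇒ {e} {k} m e∣u = ∣ε*⇒∣ (suc m) (subst (e ∣_) (U-even k m) e∣u)

-- Terms of odd index are ±1 modulo k, which rules out solutions of odd size.
∣U-odd⇒∣1 : ∀ {e k} → e ∣ k → ∀ m → e ∣ U k (suc (m * 2)) → e ∣ 1ℤ
∣U-odd⇒∣1 {e} {k} e∣k m e∣u = ∣x-y⇒∣x⇒∣y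
  (∣-trans e∣k (D≡1 (k∣σ-2 k) m))
  (∣ε*⇒∣ m (subst (e ∣_) (U-odd k m) e∣u))

-- Products over `Fin r` and prime divisors.

∏-closed : (P : ℕ → Set) → P 1 → (∀ {m n} → P m → P n → P (m * n)) →
           ∀ {r} (f : Fin r → ℕ) → (∀ i → P (f i)) → P (∏ f)
∏-closed P P1 P* {zero}  f Pf = P1
∏-closed P P1 P* {suc r} f Pf = P* (Pf zero) (∏-closed P P1 P* (f ∘ suc) (Pf ∘ suc))

∣∏ : ∀ {r} (f : Fin r → ℕ) i → f i ℕ.∣ ∏ f
∣∏ f zero    = ℕ.m∣m*n (∏ (f ∘ suc))
∣∏ f (suc i) = ℕ.∣n⇒∣m*n (f zero) (∣∏ (f ∘ suc) i)

∣^ : ∀ p {n} → 1 ≤ n → p ℕ.∣ p ^ n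
∣^ p {suc n} _ = ℕ.m∣m*n (p ^ n)

prime∣*⇒ : ∀ {p} → Prime p → ∀ x y → + p ∣ x ℤ.* y → + p ∣ x ⊎ + p ∣ y
prime∣*⇒ {p} pp x y p∣xy =
  [ inj₁ ∘ ∣ᵤ⇒∣ , inj₂ ∘ ∣ᵤ⇒∣ ]′
    (euclidsLemma ℤ.∣ x ∣ ℤ.∣ y ∣ pp (subst (p ℕ.∣_) (ℤ.abs-* x y) (∣⇒∣ᵤ p∣xy)))

prime∤1 : ∀ {p} → Prime p → ¬ + p ∣ 1ℤ
prime∤1 pp p∣1 with refl ← ℕ.∣1⇒≡1 (∣⇒∣ᵤ p∣1) = ¬prime[1] pp

-- Products of the given primes.

module _ {r} (p : Fin r → ℕ) (p-prime : ∀ i → Prime (p i)) where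

  -- Keeping the factors as a list lets both halves of the proof treat one prime at a time.
  data Smooth : ℕ → Set where
    one  : Smooth 1
    cons : ∀ i {n} → Smooth n → Smooth (p i * n)

  smooth-* : ∀ {m n} → Smooth m → Smooth n → Smooth (m * n)
  smooth-* {n = n} one Sn = subst Smooth (sym (ℕ.*-identityˡ n)) Sn
  smooth-* {n = n} (cons i {m} Sm) Sn =
    subst Smooth (sym (ℕ.*-assoc (p i) m n)) (cons i (smooth-* Sm Sn))

  smooth-^ : ∀ i e → Smooth (p i ^ e)
  smooth-^ i zero    = one
  smooth-^ i (suc e) = cons i (smooth-^ i e)

  smooth-∏^ : ∀ (e : Fin r → ℕ) → Smooth (∏ (λ i → p i ^ e i))
  smooth-∏^ e = ∏-closed Smooth one smooth-* (λ i → p i ^ e i) (λ i → smooth-^ i (e i))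

  smooth⇒nonZero : ∀ {n} → Smooth n → NonZero n
  smooth⇒nonZero one                = _
  smooth⇒nonZero (cons i {n} Sn) =
    ℕ.m*n≢0 (p i) n {{prime⇒nonZero (p-prime i)}} {{smooth⇒nonZero Sn}}

  module _ {k : ℤ} (p∣k : ∀ i → + p i ∣ k) where

    -- From modulus k at exponent 1, each prime multiplies modulus and exponent alike;
    -- `k ∣ + n ℤ.* k` is carried along for `trivial-*`.
    smooth-trivial : ∀ {n} → Smooth n → k ∣ + n ℤ.* k × Trivial k (+ n ℤ.* k) n
    smooth-trivial one = subst (λ x → k ∣ x × Trivial k x 1) (sym (ℤ.*-identityˡ k)) (∣-refl , trivial-1 k)
    smooth-trivial (cons i {n} Sn) =
      let k∣nk , tr = smooth-trivial Sn in
      subst (λ x → k ∣ x × Trivial k x (p i * n))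
        (trans (sym (ℤ.*-assoc (+ p i) (+ n) k)) (cong (ℤ._* k) (sym (ℤ.pos-* (p i) n))))
        (∣n⇒∣m*n (+ p i) k∣nk , trivial-* (p∣k i) k∣nk tr)

    p∤1+zk : ∀ z i → ¬ + p i ∣ 1ℤ ℤ.+ z ℤ.* k
    p∤1+zk z i p∣1+zk = prime∤1 (p-prime i)
      (subst (+ p i ∣_) (ring (z ℤ.* k)) (∣m∣n⇒∣m-n p∣1+zk (∣n⇒∣m*n z (p∣k i))))
      where
      ring : ∀ y → 1ℤ ℤ.+ y - y ≡ 1ℤ
      ring = solve-∀

    -- `U (σ k) m` ≡ m modulo k.
    p∣U⇒p∣ : ∀ i m → + p i ∣ U (σ k) m → p i ℕ.∣ m
    p∣U⇒p∣ i m p∣U = ∣⇒∣ᵤ (∣x-y⇒∣x⇒∣y (∣-trans (p∣k i) (U≡n (k∣σ-2 k) m)) p∣U)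

    ∣U-dilate⇒ : ∀ i {n} c m → + (p i * n) ∣ c ℤ.* U (σ k) (p i * m) →
      ∃[ z ] + n ∣ c ℤ.* (1ℤ ℤ.+ z ℤ.* k) ℤ.* U (σ k) m
    ∣U-dilate⇒ i {n} c m pn∣cU =
      let z , eq = U-dilate m (p∣k i) in
      z , *-cancelˡ-∣ (+ p i) {{prime⇒nonZero (p-prime i)}}
        (subst₂ _∣_ (ℤ.pos-* (p i) n)
          (trans (cong (c ℤ.*_) eq) (ring c (+ p i) (1ℤ ℤ.+ z ℤ.* k) (U (σ k) m)))
          pn∣cU)
      where
      ring : ∀ c q x u → c ℤ.* (q ℤ.* x ℤ.* u) ≡ q ℤ.* (c ℤ.* x ℤ.* u)
      ring = solve-∀

    -- The factor c absorbs the units produced by U-dilate.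
    smooth∣U⇒∣ : ∀ {n} → Smooth n → ∀ c → (∀ i → ¬ + p i ∣ c) →
                 ∀ m → + n ∣ c ℤ.* U (σ k) m → n ℕ.∣ m
    smooth∣U⇒∣ one c p∤c m _ = ℕ.1∣ m
    smooth∣U⇒∣ (cons i {n} Sn) c p∤c m pn∣cU =
      subst (p i * n ℕ.∣_) (sym m≡pm′)
        (ℕ.*-monoʳ-∣ (p i) (smooth∣U⇒∣ Sn (c ℤ.* (1ℤ ℤ.+ z ℤ.* k)) p∤cc′ m′ (proj₂ reduced)))
      where
      p∣m : p i ℕ.∣ m
      p∣m = [ (λ p∣c → contradiction p∣c (p∤c i)) , p∣U⇒p∣ i m ]′
        (prime∣*⇒ (p-prime i) c (U (σ k) m) (∣-trans (∣ᵤ⇒∣ (ℕ.m∣m*n n)) pn∣cU))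
      m′ = ℕ.quotient p∣m
      m≡pm′ : m ≡ p i * m′
      m≡pm′ = ℕ.m∣n⇒n≡m*quotient p∣m
      reduced = ∣U-dilate⇒ i {n} c m′
        (subst (λ j → + (p i * n) ∣ c ℤ.* U (σ k) j) m≡pm′ pn∣cU)
      z = proj₁ reduced
      p∤cc′ : ∀ j → ¬ + p j ∣ c ℤ.* (1ℤ ℤ.+ z ℤ.* k)
      p∤cc′ j p∣cc′ = [ p∤c j , p∤1+zk z j ]′
        (prime∣*⇒ (p-prime j) c (1ℤ ℤ.+ z ℤ.* k) p∣cc′)

-- Powers of M₁(k) and solutions of (E_N).

module _ (N : ℕ) where

  open Matrices (ℤ/ N)
  open Equation N

  mat-≡ : ∀ {a a′ b b′ c c′ d d′} → a ≡ a′ → b ≡ b′ → c ≡ c′ → d ≡ d′ →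
          mat a b c d ≡ mat a′ b′ c′ d′
  mat-≡ refl refl refl refl = refl

  -- Stated for positive size only, since the empty product would call for `U k` at index -1.
  M-replicate : ∀ k n → M (replicate (suc n) k) ≡
    mat (U k (2 + n)) (- U k (suc n)) (U k (suc n)) (- U k n)
  M-replicate k zero = mat-≡ (e₁₁-ring k) refl refl refl
    where
    e₁₁-ring : ∀ k → 1ℤ ℤ.* k ℤ.+ 0ℤ ℤ.* 1ℤ ≡ k ℤ.* 1ℤ - 0ℤ
    e₁₁-ring = solve-∀
  M-replicate k (suc n) = trans (cong (_· mat k (- 1ℤ) 1ℤ 0ℤ) (M-replicate k n))
    (mat-≡ (left k (U k (2 + n)) (U k (suc n))) (right (U k (2 + n)) (U k (suc n)))
           (left k (U k (suc n)) (U k n)) (right (U k (suc n)) (U k n)))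
    where
    left : ∀ k x y → x ℤ.* k ℤ.+ - y ℤ.* 1ℤ ≡ k ℤ.* x - y
    left = solve-∀
    right : ∀ x y → x ℤ.* - 1ℤ ℤ.+ - y ℤ.* 0ℤ ≡ - x
    right = solve-∀

  private
    entry₂₁ : ∀ {A B} → A ≋ B → + N ∣ e₂₁ A - e₂₁ B
    entry₂₁ eq = N∣i-j (_≋_.≈₂₁ eq)

  solution⇒∣U : ∀ {k} n → IsSolution (replicate (suc n) k) → + N ∣ U k (suc n)
  solution⇒∣U {k} n (_ , sol) = subst (+ N ∣_) (ℤ.+-identityʳ _)
    (subst (λ A → + N ∣ e₂₁ A - 0ℤ) (M-replicate k n) ([ entry₂₁ , entry₂₁ ]′ sol))

  ∣U⇒solution : ∀ {k} n {e} → e ≡ 1ℤ ⊎ e ≡ - 1ℤ →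
    + N ∣ U k (suc n) → + N ∣ U k (2 + n) - e → IsSolution (replicate (suc n) k)
  ∣U⇒solution {k} n {e} e≡±1 N∣y N∣x-e = s≤s z≤n , subst (λ A → A ≋ Id ⊎ A ≋ -Mat Id)
    (sym (M-replicate k n))
    ([ (λ { refl → inj₁ (scalar N∣x-e) }) , (λ { refl → inj₂ (scalar N∣x-e) }) ]′ e≡±1)
    where
    y = U k (suc n)
    ring : ∀ k w y e → k ℤ.* y - w - e - k ℤ.* y ≡ - w - e
    ring = solve-∀
    scalar : ∀ {e} → + N ∣ U k (2 + n) - e →
      mat (U k (2 + n)) (- y) y (- U k n) ≋ mat e 0ℤ 0ℤ e
    scalar {e} N∣x-e = mat-≈ (congruent N∣x-e)
      (congruent (subst (+ N ∣_) (sym (ℤ.+-identityʳ (- y))) (∣m⇒∣-m N∣y)))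
      (congruent (subst (+ N ∣_) (sym (ℤ.+-identityʳ y)) N∣y))
      -- By the recurrence the two diagonal entries differ by k y, which vanishes modulo N.
      (congruent (subst (+ N ∣_) (ring k (U k n) y e) (∣m∣n⇒∣m-n N∣x-e (∣n⇒∣m*n k N∣y))))

  -- (-M₁(k)²)ᵐ ≡ Id turns into M₁(k)²ᵐ ≡ (-1)ᵐ Id, so `ε m` selects the sign.
  trivial⇒solution : ∀ {k c m} → 1 ≤ m → + N ∣ c → Trivial k c m → IsSolution (replicate (2 * m) k)
  trivial⇒solution {k} {c} {suc m} _ N∣c tr =
    subst (λ s → IsSolution (replicate s k)) (ℕ.*-comm (suc m) 2)
      (∣U⇒solution {k} (suc (m * 2)) (ε≡±1 (suc m))
        (subst (+ N ∣_) (sym (U-even k (suc m))) (∣n⇒∣m*n (- ε (suc m)) (∣-trans N∣c c∣kU)))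
        (subst (+ N ∣_) (sym (trans (cong (_- ε (suc m)) (U-odd k (suc m))) (ring (ε (suc m)) (D (σ k) (suc m)))))
          (∣n⇒∣m*n (ε (suc m)) (∣-trans N∣c c∣D-1))))
    where
    open Trivial tr
    ring : ∀ e x → e ℤ.* x - e ≡ e ℤ.* (x - 1ℤ)
    ring = solve-∀

-- The minimal size.

parity : ∀ n → ∃[ m ] (n ≡ m * 2 ⊎ n ≡ suc (m * 2))
parity n with n ℕ.divMod 2
... | ℕ.result m zero       eq = m , inj₁ eq
... | ℕ.result m (suc zero) eq = m , inj₂ eq

proposition4p1 : ∀ (r : ℕ) → 1 ≤ r →
    (p α β : Fin r → ℕ) →
    (∀ i → Prime (p i)) →
    Injective _≡_ _≡_ p →
    (∀ i → 1 ≤ α i) →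
    (∀ i → 1 ≤ β i) →
    (∀ i → β i ≤ α i) →
    (a : ℤ) → (∀ i → ¬ (+ p i) ℤ.∣ a) →
    (N : ℕ) → N ≡ ∏ (λ i → p i ^ α i) →
    (k : ℤ) → k ≡ a ℤ.* + ∏ (λ i → p i ^ β i) →
    Σ[ as ∈ Vec ℤ (2 * ∏ (λ i → p i ^ (α i ∸ β i))) ]
    Equation.IsMonomialMinimalSolution N k as
proposition4p1 r@(suc _) _ p α β p-prime _ 1≤α 1≤β β≤α a p∤a N refl k refl =
  replicate (2 * Q) k , record
    { monomial   = Pointwise.refl (CommutativeRing.refl (ℤ/ N))
    ; isSolution = trivial⇒solution N 1≤Q N∣Qk (proj₂ (smooth-trivial p p-prime p∣k Q-smooth))
    ; minimal    = minimal
    }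
  where
  open Equation N
  Q = ∏ (λ i → p i ^ (α i ∸ β i))
  K = ∏ (λ i → p i ^ β i)

  Q-smooth : Smooth p p-prime Q
  Q-smooth = smooth-∏^ p p-prime (λ i → α i ∸ β i)

  instance
    K≢0 : NonZero K
    K≢0 = smooth⇒nonZero p p-prime (smooth-∏^ p p-prime β)

  1≤Q : 1 ≤ Q
  1≤Q = >-nonZero⁻¹ Q {{smooth⇒nonZero p p-prime Q-smooth}}

  N≡QK : N ≡ Q * K
  N≡QK = trans
    -- The monoid is (ℕ, *, 1), so these "sum" laws speak of products.
    (sum-cong-≋ (λ i → trans (cong (p i ^_) (sym (ℕ.m∸n+n≡m (β≤α i))))
                             (ℕ.^-distribˡ-+-* (p i) (α i ∸ β i) (β i))))
    (∑-distrib-+ (λ i → p i ^ (α i ∸ β i)) (λ i → p i ^ β i))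

  +N≡QK : + N ≡ + Q ℤ.* + K
  +N≡QK = trans (cong +_ N≡QK) (ℤ.pos-* Q K)

  p∣k : ∀ i → + p i ∣ k
  p∣k i = ∣n⇒∣m*n a (∣ᵤ⇒∣ (ℕ.∣-trans (∣^ (p i) (1≤β i)) (∣∏ (λ i → p i ^ β i) i)))

  p∣N : ∀ i → + p i ∣ + N
  p∣N i = ∣ᵤ⇒∣ (ℕ.∣-trans (∣^ (p i) (1≤α i)) (∣∏ (λ i → p i ^ α i) i))

  N∣Qk : + N ∣ + Q ℤ.* k
  N∣Qk = subst (_∣ + Q ℤ.* k) (sym +N≡QK) (*-monoʳ-∣ (+ Q) (∣n⇒∣m*n a ∣-refl))

  N∣kU⇒Q∣ : ∀ m → + N ∣ k ℤ.* U (σ k) m → Q ℕ.∣ m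
  -- Cancelling K from N = Q K and k = a K leaves Q ∣ a U, so the accumulated factor starts at a.
  N∣kU⇒Q∣ m N∣kU = smooth∣U⇒∣ p p-prime p∣k Q-smooth a (λ i → p∤a i ∘ ∣⇒∣ᵤ) m
    (*-cancelʳ-∣ (+ K) (subst₂ _∣_ +N≡QK (ring a (+ K) (U (σ k) m)) N∣kU))
    where
    ring : ∀ a x u → a ℤ.* x ℤ.* u ≡ a ℤ.* u ℤ.* x
    ring = solve-∀

  minimal : ∀ t → IsSolution (replicate t k) → 2 * Q ≤ t
  -- Size 0 is excluded by the positivity in `IsSolution`.
  minimal (suc n) sol with solution⇒∣U N n sol | parity (suc n)
  -- Odd size: the first prime, present because r ≥ 1, divides both k and N and would divide 1.
  ... | N∣U | m , inj₂ eq = contradiction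
    (∣U-odd⇒∣1 {k = k} (p∣k zero) m (subst (λ s → + p zero ∣ U k s) eq (∣-trans (p∣N zero) N∣U)))
    (prime∤1 (p-prime zero))
  ... | N∣U | zero , inj₁ ()
  ... | N∣U | m@(suc _) , inj₁ eq = subst (2 * Q ≤_) (trans (ℕ.*-comm 2 m) (sym eq))
    (ℕ.*-monoʳ-≤ 2 (ℕ.∣⇒≤ (N∣kU⇒Q∣ m (∣U-even⇒ {k = k} m (subst (λ s → + N ∣ U k s) eq N∣U)))))
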